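{- There is an absolute constant $C>0$ such that the following holds. For any $\varepsilon>0$ there is a $\delta=\delta(\varepsilon)\ge 2^{ -C/\varepsilon}$ (i.e. $\delta=2^{ -O(1/\varepsilon)}$) such that for every bipartite graph $G$ with bipartition $X\cup Y$, $|X|=n$ and $|Y|=2n$, if $\mathrm{im}(G)<(1-\varepsilon)n$, then $\log\mathrm{mis}(G)<(1-\delta)n$.
   Context: $\mathrm{mis}(G)$ denotes the number of maximal independent sets of $G$, and $\log=\log_2$. An induced matching of $G$ is an induced subgraph of $G$ that is a matching; $\mathrm{im}(G)$ is the number of edges in a largest induced matching of $G$. -}

module Defs where

open import Data.Nat using (ℕ; zero; suc; _+_; _*_)
open import Data.Fin using (Fin; _↑ˡ_; _↑ʳ_)
open import Data.Fin.Subset using (Subset)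
open import Data.Bool using (Bool; true; false; not; _∧_; _∨_; if_then_else_)
open import Data.Vec using (Vec; []; _∷_; lookup)
open import Data.List using (List; []; _∷_; _++_; map; allFin)
open import Data.Bool.ListAction using (all)
open import Data.Nat.ListAction using (sum)
open import Data.Sum using (_⊎_; inj₁; inj₂)
open import Data.Product using (_×_)
open import Data.Empty using (⊥)
open import Relation.Binary.PropositionalEquality using (_≡_)
open import Function.Definitions using (Injective)

record Graph (N : ℕ) : Set where
  field
    adj    : Fin N → Fin N → Bool
    sym    : ∀ u v → adj u v ≡ adj v u
    irrefl : ∀ v → adj v v ≡ false
open Graph public

allSubsets : ∀ N → List (Subset N)
allSubsets zero    = [] ∷ []
allSubsets (suc N) = map (true ∷_) (allSubsets N) ++ map (false ∷_) (allSubsets N)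

independentᵇ : ∀ {N} → Graph N → Subset N → Bool
independentᵇ {N} G S =
  all (λ u → all (λ v → not (lookup S u ∧ lookup S v ∧ adj G u v)) (allFin N)) (allFin N)

subsetᵇ : ∀ {N} → Subset N → Subset N → Bool
subsetᵇ {N} S T = all (λ u → not (lookup S u) ∨ lookup T u) (allFin N)

sameᵇ : ∀ {N} → Subset N → Subset N → Bool
sameᵇ S T = subsetᵇ S T ∧ subsetᵇ T S

maximalIndependentᵇ : ∀ {N} → Graph N → Subset N → Bool
maximalIndependentᵇ {N} G S =
  independentᵇ G S ∧
  all (λ T → not (subsetᵇ S T ∧ independentᵇ G T) ∨ sameᵇ T S) (allSubsets N)

mis : ∀ {N} → Graph N → ℕ
mis {N} G = sum (map (λ S → if maximalIndependentᵇ G S then 1 else 0) (allSubsets N))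

-- In an induced matching with k edges, indexed by Fin k ⊎ Fin k, vertex
-- (inj₁ i) is matched with (inj₂ i).
Partner : ∀ {k} → Fin k ⊎ Fin k → Fin k ⊎ Fin k → Set
Partner (inj₁ i) (inj₂ j) = i ≡ j
Partner (inj₂ i) (inj₁ j) = i ≡ j
Partner (inj₁ _) (inj₁ _) = ⊥
Partner (inj₂ _) (inj₂ _) = ⊥

IsInducedMatching : ∀ {N} → Graph N → (k : ℕ) → (Fin k ⊎ Fin k → Fin N) → Set
IsInducedMatching G k M =
  Injective _≡_ _≡_ M ×
  (∀ p q → (adj G (M p) (M q) ≡ true → Partner p q) × (Partner p q → adj G (M p) (M q) ≡ true))

vX : ∀ n → Fin n → Fin (n + 2 * n)
vX n i = i ↑ˡ (2 * n)

vY : ∀ n → Fin (2 * n) → Fin (n + 2 * n)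
vY n j = n ↑ʳ j

BipartiteXY : ∀ n → Graph (n + 2 * n) → Set
BipartiteXY n G =
  (∀ i i' → adj G (vX n i) (vX n i') ≡ false) ×
  (∀ j j' → adj G (vY n j) (vY n j') ≡ false)

{-# OPTIONS --safe #-}
-- A maximal independent set of G is determined by its trace T on X, so mis(G)
-- counts traces. Let M and P = M + 1 be large integers and K an odd integer of
-- order 1/ε. If no induced matching has more than k edges, then
--   mis(G) ≤ 2ⁿ (P/M)^(|Y| + Kk − Kn),
-- by induction on the number of undecided vertices of X: 2 per undecided vertex
-- is the trivial bound, each undecided vertex gains a factor (M/P)^K and each
-- vertex of Y not yet adjacent to T costs a factor P/M. If every undecided x
-- has a neighbour adjacent to no other undecided vertex, these form an induced
-- matching, and there are at most k of them. Otherwise take x without such a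
-- neighbour. If x has many live neighbours, putting x into T kills them all,
-- which pays for the branching on x. If it has few, hit each of them by a second
-- undecided vertex; the assignment with x ∉ T and all these vertices in T cannot
-- occur, and the missing fraction 2^(−O(K)) pays for the branching.
-- With 1/r ≤ ε and K = 2r + 1 the exponent |Y| + Kk − Kn is less than −n/r.
module Submission where

open import Defs hiding (sym)
open import Data.Bool using (Bool; true; false; not; _∧_; _∨_; if_then_else_)
open import Data.Bool.ListAction using (all)
import Data.Bool.Properties as Bool
open import Data.Fin using (Fin; zero; suc; splitAt)
import Data.Fin.Properties as Fin
open import Data.Fin.Subset using (Subset; _∈_; _∉_; ∣_∣; _∩_; _─_; ⊤)
open import Data.Fin.Subset.Properties
  using (_∈?_; ∈⊤; ∣⊤∣≡n; nonempty?; p⊂q⇒∣p∣<∣q∣; p⊆q⇒∣p∣≤∣q∣; x∈p∩q⁺; x∈p∩q⁻; x∈p∧x∉q⇒x∈p─q; p─q⊆p)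
open import Data.List using ([]; _∷_; map; allFin)
import Data.List.Membership.Propositional as List∈
open import Data.List.Membership.Propositional.Properties using (∈-allFin; ∈-map⁺; ∈-++⁺ˡ; ∈-++⁺ʳ)
open import Data.List.Properties using (map-++; map-∘)
open import Data.List.Relation.Unary.Any using (here; there)
open import Data.Maybe using (Maybe; just; nothing)
import Data.Maybe.Properties as Maybe
open import Data.Nat
open import Data.Nat.DivMod using (_/_; _%_; m/n*n≤m; m≡m%n+[m/n]*n; m%n<n; m*n/n≡m; /-monoˡ-≤)
open import Data.Nat.ListAction using (sum)
open import Data.Nat.ListAction.Properties using (sum-++)
open import Data.Nat.Properties
open import Data.Nat.Tactic.RingSolver using (solve-∀)
open import Data.Product using (Σ; ∃; _×_; _,_; proj₁; proj₂)
open import Data.Sum using (_⊎_; inj₁; inj₂)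
open import Data.Vec using (Vec; []; _∷_; lookup; _[_]≔_; replicate; tabulate; _++_; head; tail; there)
open import Data.Vec.Properties
  using (lookup∘updateAt; lookup∘updateAt′; lookup∘tabulate; []=⇒lookup; lookup⇒[]=; lookup-++ˡ; lookup-++ʳ;
         tabulate∘lookup; tabulate-cong)
open import Function using (_∘_; it)
open import Relation.Binary.PropositionalEquality
  using (_≡_; _≢_; refl; sym; trans; cong; cong₂; subst; subst₂)
open import Relation.Nullary using (¬_; Dec; yes; no; does; contradiction; ¬?; _×-dec_)
open import Relation.Nullary.Decidable using (decidable-stable)

^-distribʳ-* : ∀ m n o → (m * n) ^ o ≡ m ^ o * n ^ o
^-distribʳ-* m n zero    = refl
^-distribʳ-* m n (suc o) = trans (cong (m * n *_) (^-distribʳ-* m n o)) (interchange m n (m ^ o) (n ^ o))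
  where
  interchange : ∀ a b c d → a * b * (c * d) ≡ a * c * (b * d)
  interchange = solve-∀

-- Partial assignments and sums over their extensions.

-- A stage of the branching on X: `just true` puts a vertex into T, `just false` keeps it out,
-- `nothing` leaves it undecided.
PartialAssignment : ℕ → Set
PartialAssignment n = Vec (Maybe Bool) n

free : ∀ {n} → PartialAssignment n → ℕ
free []            = 0
free (nothing ∷ ρ) = suc (free ρ)
free (just _ ∷ ρ)  = free ρ

∑ : ∀ {n} → PartialAssignment n → (Subset n → ℕ) → ℕ
∑ []            f = f []
∑ (nothing ∷ ρ) f = ∑ ρ (f ∘ (true ∷_)) + ∑ ρ (f ∘ (false ∷_))
∑ (just b ∷ ρ)  f = ∑ ρ (f ∘ (b ∷_))

Free : ∀ {n} → PartialAssignment n → Fin n → Set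
Free ρ x = lookup ρ x ≡ nothing

free? : ∀ {n} (ρ : PartialAssignment n) x → Dec (Free ρ x)
free? ρ x = Maybe.≡-dec Bool._≟_ (lookup ρ x) nothing

Extends : ∀ {n} → PartialAssignment n → Subset n → Set
Extends ρ T = ∀ z b → lookup ρ z ≡ just b → lookup T z ≡ b

free-[]≔ : ∀ {n} (ρ : PartialAssignment n) x b → Free ρ x → suc (free (ρ [ x ]≔ just b)) ≡ free ρ
free-[]≔ (nothing ∷ ρ) zero    b refl = refl
free-[]≔ (nothing ∷ ρ) (suc x) b eq   = cong suc (free-[]≔ ρ x b eq)
free-[]≔ (just _ ∷ ρ)  (suc x) b eq   = free-[]≔ ρ x b eq

∑-branch : ∀ {n} (ρ : PartialAssignment n) x f → Free ρ x →
  ∑ ρ f ≡ ∑ (ρ [ x ]≔ just true) f + ∑ (ρ [ x ]≔ just false) f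
∑-branch (nothing ∷ ρ) zero    f refl = refl
∑-branch (just b ∷ ρ)  (suc x) f eq   = ∑-branch ρ x (f ∘ (b ∷_)) eq
∑-branch (nothing ∷ ρ) (suc x) f eq   = trans
  (cong₂ _+_ (∑-branch ρ x (f ∘ (true ∷_)) eq) (∑-branch ρ x (f ∘ (false ∷_)) eq))
  (interchange (∑ (ρ [ x ]≔ just true) (f ∘ (true ∷_))) _ _ _)
  where
  interchange : ∀ a b c d → (a + b) + (c + d) ≡ (a + c) + (b + d)
  interchange = solve-∀

∑-≤-2^ : ∀ {n} (ρ : PartialAssignment n) {f} → (∀ T → f T ≤ 1) → ∑ ρ f ≤ 2 ^ free ρ
∑-≤-2^ []            f≤1 = f≤1 []
∑-≤-2^ (just b ∷ ρ)  f≤1 = ∑-≤-2^ ρ (f≤1 ∘ (b ∷_))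
∑-≤-2^ (nothing ∷ ρ) f≤1 = +-mono-≤ (∑-≤-2^ ρ (f≤1 ∘ (true ∷_)))
  (≤-trans (∑-≤-2^ ρ (f≤1 ∘ (false ∷_))) (m≤m+n _ 0))

∑-zero : ∀ {n} (ρ : PartialAssignment n) {f} → (∀ T → Extends ρ T → f T ≡ 0) → ∑ ρ f ≡ 0
∑-zero []            f≡0 = f≡0 [] λ ()
∑-zero (just b ∷ ρ)  f≡0 = ∑-zero ρ λ T ext → f≡0 (b ∷ T)
  λ { zero _ refl → refl ; (suc z) → ext z }
∑-zero (nothing ∷ ρ) f≡0 = cong₂ _+_ (half true) (half false)
  where
  half : ∀ b → ∑ ρ _ ≡ 0
  half b = ∑-zero ρ λ T ext → f≡0 (b ∷ T) λ { zero _ () ; (suc z) → ext z }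

enumerate-free : ∀ {n} (ρ : PartialAssignment n) → Fin (free ρ) → Fin n
enumerate-free (nothing ∷ ρ) zero    = zero
enumerate-free (nothing ∷ ρ) (suc i) = suc (enumerate-free ρ i)
enumerate-free (just _ ∷ ρ)  i       = suc (enumerate-free ρ i)

enumerate-free-Free : ∀ {n} (ρ : PartialAssignment n) i → Free ρ (enumerate-free ρ i)
enumerate-free-Free (nothing ∷ ρ) zero    = refl
enumerate-free-Free (nothing ∷ ρ) (suc i) = enumerate-free-Free ρ i
enumerate-free-Free (just _ ∷ ρ)  i       = enumerate-free-Free ρ i

enumerate-free-injective : ∀ {n} (ρ : PartialAssignment n) i j →
  enumerate-free ρ i ≡ enumerate-free ρ j → i ≡ j
enumerate-free-injective (nothing ∷ ρ) zero    zero    eq = refl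
enumerate-free-injective (nothing ∷ ρ) (suc i) (suc j) eq =
  cong suc (enumerate-free-injective ρ i j (Fin.suc-injective eq))
enumerate-free-injective (just _ ∷ ρ)  i       j       eq =
  enumerate-free-injective ρ i j (Fin.suc-injective eq)

-- Set differences.

∣p─q∣+∣p∩q∣≡∣p∣ : ∀ {n} (p q : Subset n) → ∣ p ─ q ∣ + ∣ p ∩ q ∣ ≡ ∣ p ∣
∣p─q∣+∣p∩q∣≡∣p∣ []          []          = refl
∣p─q∣+∣p∩q∣≡∣p∣ (true ∷ p)  (true ∷ q)  = trans (+-suc _ _) (cong suc (∣p─q∣+∣p∩q∣≡∣p∣ p q))
∣p─q∣+∣p∩q∣≡∣p∣ (true ∷ p)  (false ∷ q) = cong suc (∣p─q∣+∣p∩q∣≡∣p∣ p q)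
∣p─q∣+∣p∩q∣≡∣p∣ (false ∷ p) (true ∷ q)  = ∣p─q∣+∣p∩q∣≡∣p∣ p q
∣p─q∣+∣p∩q∣≡∣p∣ (false ∷ p) (false ∷ q) = ∣p─q∣+∣p∩q∣≡∣p∣ p q

x∈q⇒x∉p─q : ∀ {n} {x : Fin n} (p q : Subset n) → x ∈ q → x ∉ p ─ q
x∈q⇒x∉p─q {x = zero}  (_ ∷ p) (true ∷ q) _ ()
x∈q⇒x∉p─q {x = suc x} (_ ∷ p) (_ ∷ q) (there x∈q) (there x∈) = x∈q⇒x∉p─q p q x∈q x∈

-- The weighted count of traces on X.

-- A bipartite graph is given by the neighbourhoods A x ⊆ Y of the vertices x
-- of X. The weight f is supported on those T ⊆ X that are the traces of
-- maximal independent sets: each x ∉ T has a neighbour with no neighbour in T.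
module Counting {n m : ℕ} (A : Fin n → Subset m) (f : Subset n → ℕ)
  (f≤1 : ∀ T → f T ≤ 1)
  (f-support : ∀ T x → lookup T x ≡ false →
    (∀ y → y ∈ A x → ∃ λ z → lookup T z ≡ true × y ∈ A z) → f T ≡ 0)
  (k : ℕ)
  (matching-bound : ∀ j (xs : Fin j → Fin n) (ys : Fin j → Fin m) →
    (∀ i → ys i ∈ A (xs i)) → (∀ i i′ → ys i ∈ A (xs i′) → i′ ≡ i) → j ≤ k)
  (M P K D : ℕ) (M≤P : M ≤ P)
  (gain₁ : P ^ K * (M ^ D + P ^ D) ≤ 2 * M ^ K * P ^ D)
  (gain₂ : (2 * P ^ K) ^ D ≤ (2 * M ^ K) ^ D + (P ^ K) ^ D)
  .{{_ : NonZero M}}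
  where

  S U : ℕ
  S = P ^ K
  U = M ^ K

  -- One-sided: `alive` has to contain each vertex of Y that has no neighbour in T so far, so a
  -- vertex outside it is certified as dead.
  Covers : PartialAssignment n → Subset m → Set
  Covers ρ alive = ∀ y → y ∉ alive → ∃ λ z → lookup ρ z ≡ just true × y ∈ A z

  Blocked : PartialAssignment n → Fin n → Fin m → Set
  Blocked ρ x y = ∃ λ z → Free ρ z × y ∈ A z × z ≢ x

  blocked? : ∀ ρ x y → Dec (Blocked ρ x y)
  blocked? ρ x y = Fin.any? λ z → free? ρ z ×-dec y ∈? A z ×-dec ¬? (z Fin.≟ x)

  Private : PartialAssignment n → Fin n → Set
  Private ρ x = ∃ λ y → y ∈ A x × ¬ Blocked ρ x y

  private? : ∀ ρ x → Dec (Private ρ x)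
  private? ρ x = Fin.any? λ y → y ∈? A x ×-dec ¬? (blocked? ρ x y)

  all-private⇒free≤k : ∀ ρ → (∀ x → Free ρ x → Private ρ x) → free ρ ≤ k
  all-private⇒free≤k ρ priv = matching-bound (free ρ) (enumerate-free ρ)
    (λ i → proj₁ (p i)) (λ i → proj₁ (proj₂ (p i)))
    λ i i′ y∈ → decidable-stable (i′ Fin.≟ i) λ i′≢i → proj₂ (proj₂ (p i))
      (enumerate-free ρ i′ , enumerate-free-Free ρ i′ , y∈ , i′≢i ∘ enumerate-free-injective ρ i′ i)
    where
    p : ∀ i → Private ρ (enumerate-free ρ i)
    p i = priv _ (enumerate-free-Free ρ i)

  module _ (ρ : PartialAssignment n) {x : Fin n} (x-free : Free ρ x) where

    still-set : ∀ {c} b z → lookup ρ z ≡ just c → lookup (ρ [ x ]≔ just b) z ≡ just c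
    still-set b z eq = trans (lookup∘updateAt′ z x (λ { refl → contradiction (trans (sym eq) x-free) λ () }) ρ) eq

    covers-[]≔ : ∀ {alive} b → Covers ρ alive → Covers (ρ [ x ]≔ just b) alive
    covers-[]≔ b cov y y∉ with z , z-true , y∈Az ← cov y y∉ = z , still-set b z z-true , y∈Az

    covers-remove : ∀ {alive} → Covers ρ alive → Covers (ρ [ x ]≔ just true) (alive ─ A x)
    covers-remove cov y y∉ with y ∈? A x
    ... | yes y∈Ax = x , lookup∘updateAt x ρ , y∈Ax
    ... | no  y∉Ax = covers-[]≔ true cov y λ y∈ → y∉ (x∈p∧x∉q⇒x∈p─q y∈ y∉Ax)

  -- All neighbours of `x` are dead, hence already adjacent to vertices fixed in T, and `f-support`
  -- rules out every extension.
  uncovered⇒∑≡0 : ∀ ρ alive x → Covers ρ alive → lookup ρ x ≡ just false →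
    (∀ y → y ∈ alive → y ∉ A x) → ∑ ρ f ≡ 0
  uncovered⇒∑≡0 ρ alive x cov x-false none = ∑-zero ρ λ T ext →
    f-support T x (ext x false x-false) λ y y∈Ax →
      let z , z-true , y∈Az = cov y (λ y∈ → none y y∈ y∈Ax) in z , ext z true z-true , y∈Az

  ∣─∣≤ : ∀ {e} (p q : Subset m) → K * k + ∣ p ∣ ≤ e → K * k + ∣ p ─ q ∣ ≤ e
  ∣─∣≤ p q = ≤-trans (+-monoʳ-≤ (K * k) (p⊆q⇒∣p∣≤∣q∣ (p─q⊆p p q)))

  S≥U : U ≤ S
  S≥U = ^-monoˡ-≤ K M≤P

  -- When `K * ℓ ≤ e`, the cost (P/M)^e outweighs the gain (M/P)^(Kℓ), so the claim is no stronger
  -- than the trivial bound `2 ^ ℓ`.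
  few-free : ∀ ℓ e F → F ≤ 2 ^ ℓ → K * ℓ ≤ e → F * (S ^ ℓ * M ^ e) ≤ (2 * U) ^ ℓ * P ^ e
  few-free ℓ e F F≤ Kℓ≤e with c , refl ← m≤n⇒∃[o]m+o≡n Kℓ≤e = begin
    F * (S ^ ℓ * M ^ (K * ℓ + c))
      ≡⟨ cong₂ (λ s m → F * (s * m)) (^-*-assoc P K ℓ) (^-distribˡ-+-* M (K * ℓ) c) ⟩
    F * (P ^ (K * ℓ) * (M ^ (K * ℓ) * M ^ c))
      ≤⟨ *-mono-≤ F≤ (*-monoʳ-≤ (P ^ (K * ℓ)) (*-monoʳ-≤ (M ^ (K * ℓ)) (^-monoˡ-≤ c M≤P))) ⟩
    2 ^ ℓ * (P ^ (K * ℓ) * (M ^ (K * ℓ) * P ^ c))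
      ≡⟨ rearrange (2 ^ ℓ) (P ^ (K * ℓ)) (M ^ (K * ℓ)) (P ^ c) ⟩
    2 ^ ℓ * M ^ (K * ℓ) * (P ^ (K * ℓ) * P ^ c)
      ≡⟨ cong₂ _*_ (cong (2 ^ ℓ *_) (^-*-assoc M K ℓ)) (^-distribˡ-+-* P (K * ℓ) c) ⟨
    2 ^ ℓ * U ^ ℓ * P ^ (K * ℓ + c)
      ≡⟨ cong (_* P ^ (K * ℓ + c)) (^-distribʳ-* 2 U ℓ) ⟨
    (2 * U) ^ ℓ * P ^ (K * ℓ + c) ∎
    where
    open ≤-Reasoning
    rearrange : ∀ a b c d → a * (b * (c * d)) ≡ a * c * (b * d)
    rearrange = solve-∀

  -- One step of the chain: `F₁` is the branch that continues it and misses a fraction 2^(-j), `F₀`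
  -- the side branch with the ordinary bound. Averaging, ((1 - 2^(-j)) + 1)/2 = 1 - 2^(-j-1), and
  -- the decided vertex contributes the extra factor S/U.
  chain-step : ∀ {F₀ F₁ a b c d h s hⱼ sⱼ tⱼ} → hⱼ ≤ tⱼ →
    F₁ * (a * b) * hⱼ + sⱼ * (c * d) ≤ tⱼ * (c * d) → F₀ * (a * b) ≤ c * d →
    (F₁ + F₀) * (s * a * b) * (h * hⱼ) + s * sⱼ * (h * c * d) ≤ 2 * s * tⱼ * (h * c * d)
  chain-step {F₀} {F₁} {a} {b} {c} {d} {h} {s} {hⱼ} {sⱼ} {tⱼ} hⱼ≤tⱼ bound₁ bound₀ = begin
    (F₁ + F₀) * (s * a * b) * (h * hⱼ) + s * sⱼ * (h * c * d)
      ≡⟨ left F₁ F₀ a b c d h s hⱼ sⱼ ⟩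
    h * s * (F₁ * (a * b) * hⱼ + sⱼ * (c * d) + F₀ * (a * b) * hⱼ)
      ≤⟨ *-monoʳ-≤ (h * s) (+-mono-≤ bound₁ (*-mono-≤ bound₀ hⱼ≤tⱼ)) ⟩
    h * s * (tⱼ * (c * d) + c * d * tⱼ)
      ≡⟨ right c d h s tⱼ ⟩
    2 * s * tⱼ * (h * c * d) ∎
    where
    open ≤-Reasoning
    left : ∀ F₁ F₀ a b c d h s hⱼ sⱼ → (F₁ + F₀) * (s * a * b) * (h * hⱼ) + s * sⱼ * (h * c * d) ≡
      h * s * (F₁ * (a * b) * hⱼ + sⱼ * (c * d) + F₀ * (a * b) * hⱼ)
    left = solve-∀
    right : ∀ c d h s t → h * s * (t * (c * d) + c * d * t) ≡ 2 * s * t * (h * c * d)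
    right = solve-∀

  -- Killing D live vertices multiplies the bound for the branch `F₁` by m/p = (M/P)^D, so the two
  -- branches average to (m/p + 1)/2. The hypothesis `gain` says that this is at most u/s.
  branch-step : ∀ {F₀ F₁ a b c d u s m p} → s * (m + p) ≤ 2 * u * p →
    F₁ * (a * b) ≤ c * d → F₀ * (a * (b * m)) ≤ c * (d * p) →
    (F₁ + F₀) * (s * a * (b * m)) ≤ 2 * u * c * (d * p)
  branch-step {F₀} {F₁} {a} {b} {c} {d} {u} {s} {m} {p} gain bound₁ bound₀ = begin
    (F₁ + F₀) * (s * a * (b * m))
      ≡⟨ left F₁ F₀ a b s m ⟩
    s * (F₁ * (a * b) * m + F₀ * (a * (b * m)))
      ≤⟨ *-monoʳ-≤ s (+-mono-≤ (*-monoˡ-≤ m bound₁) bound₀) ⟩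
    s * (c * d * m + c * (d * p))
      ≡⟨ mid c d s m p ⟩
    c * d * (s * (m + p))
      ≤⟨ *-monoʳ-≤ (c * d) gain ⟩
    c * d * (2 * u * p)
      ≡⟨ right c d u p ⟩
    2 * u * c * (d * p) ∎
    where
    open ≤-Reasoning
    left : ∀ F₁ F₀ a b s m → (F₁ + F₀) * (s * a * (b * m)) ≡ s * (F₁ * (a * b) * m + F₀ * (a * (b * m)))
    left = solve-∀
    mid : ∀ c d s m p → s * (c * d * m + c * (d * p)) ≡ c * d * (s * (m + p))
    mid = solve-∀
    right : ∀ c d u p → c * d * (2 * u * p) ≡ 2 * u * c * (d * p)
    right = solve-∀

  -- After D steps the chain yields the desired bound times (1 - 2^(-D))(S/U)^D. The gain inequality
  -- reads 1 - 2^(-D) ≤ (U/S)^D, so that factor is at most 1.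
  conclude : ∀ D {F s v} → (2 * S) ^ D ≤ (2 * U) ^ D + S ^ D →
    F * s * (2 * U) ^ D + S ^ D * v ≤ (2 * S) ^ D * v → F * s ≤ v
  conclude D {F} {s} {v} gain bound = *-cancelʳ-≤ (F * s) v ((2 * U) ^ D) {{m^n≢0 (2 * U) D {{m*n≢0 2 U {{_}} {{m^n≢0 M K}}}}}}
    (+-cancelʳ-≤ (S ^ D * v) _ _ (begin
      F * s * (2 * U) ^ D + S ^ D * v ≤⟨ bound ⟩
      (2 * S) ^ D * v                 ≤⟨ *-monoˡ-≤ v gain ⟩
      ((2 * U) ^ D + S ^ D) * v       ≡⟨ *-distribʳ-+ v ((2 * U) ^ D) (S ^ D) ⟩
      (2 * U) ^ D * v + S ^ D * v     ≡⟨ cong (_+ S ^ D * v) (*-comm ((2 * U) ^ D) v) ⟩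
      v * (2 * U) ^ D + S ^ D * v     ∎))
    where open ≤-Reasoning

  -- With denominators cleared, this is ∑ ρ f ≤ 2^ℓ (M/P)^(Kℓ) (P/M)^e. Since `e` is only bounded
  -- from below, it can stay fixed along a chain while `alive` shrinks. The induction on `ℓ` is
  -- mutual with `bound-uncovered`.
  bound : ∀ ℓ ρ alive e → free ρ ≡ ℓ → Covers ρ alive → K * k + ∣ alive ∣ ≤ e →
    ∑ ρ f * (S ^ ℓ * M ^ e) ≤ (2 * U) ^ ℓ * P ^ e
  -- x is not in T, hence needs a neighbour with no neighbour in T; every live
  -- neighbour of x has another undecided neighbour, and branching on those
  -- runs out of live neighbours after at most j steps. The bound is the one
  -- above times (1 − 2⁻ʲ)(S/U)ʲ, with the subtraction moved to the left.
  bound-uncovered : ∀ ℓ j ρ alive e x → free ρ ≡ ℓ → Covers ρ alive → K * k + ∣ alive ∣ ≤ e →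
    lookup ρ x ≡ just false → (∀ y → y ∈ alive → y ∈ A x → ∃ λ z → Free ρ z × y ∈ A z) →
    ∣ alive ∩ A x ∣ ≤ j →
    ∑ ρ f * (S ^ ℓ * M ^ e) * (2 * U) ^ j + S ^ j * ((2 * U) ^ ℓ * P ^ e) ≤
      (2 * S) ^ j * ((2 * U) ^ ℓ * P ^ e)

  bound zero ρ alive e ℓ≡ cov e≥ = few-free 0 e (∑ ρ f)
    (subst (λ t → ∑ ρ f ≤ 2 ^ t) ℓ≡ (∑-≤-2^ ρ f≤1)) (subst (_≤ e) (sym (*-zeroʳ K)) z≤n)
  bound (suc ℓ) ρ alive e ℓ≡ cov e≥ with Fin.any? (λ x → free? ρ x ×-dec ¬? (private? ρ x))
  ... | no ∄x = few-free (suc ℓ) e (∑ ρ f)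
    (subst (λ t → ∑ ρ f ≤ 2 ^ t) ℓ≡ (∑-≤-2^ ρ f≤1))
    (≤-trans (*-monoʳ-≤ K (subst (_≤ k) ℓ≡ (all-private⇒free≤k ρ λ x x-free →
      decidable-stable (private? ρ x) λ np → ∄x (x , x-free , np)))) (m+n≤o⇒m≤o (K * k) e≥))
  ... | yes (x , x-free , not-private) rewrite ∑-branch ρ x f x-free =
    -- `D` is generalised together with its two inequalities so that it can be matched as `suc J`.
    go D gain₁ gain₂
    where
    ρ₀ ρ₁ : PartialAssignment n
    ρ₀ = ρ [ x ]≔ just false
    ρ₁ = ρ [ x ]≔ just true

    freeᵇ : ∀ b → free (ρ [ x ]≔ just b) ≡ ℓ
    freeᵇ b = suc-injective (trans (free-[]≔ ρ x b x-free) ℓ≡)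

    -- Having no private neighbour, `x` shares each neighbour with another undecided vertex, which
    -- deciding `x` leaves undecided.
    other : ∀ y → y ∈ alive → y ∈ A x → ∃ λ z → Free ρ₀ z × y ∈ A z
    other y _ y∈ with z , z-free , y∈z , z≢x ← decidable-stable (blocked? ρ x y) (λ nb → not-private (y , y∈ , nb))
      = z , trans (lookup∘updateAt′ z x z≢x ρ) z-free , y∈z

    go : ∀ D → S * (M ^ D + P ^ D) ≤ 2 * U * P ^ D → (2 * S) ^ D ≤ (2 * U) ^ D + S ^ D →
      (∑ ρ₁ f + ∑ ρ₀ f) * (S ^ suc ℓ * M ^ e) ≤ (2 * U) ^ suc ℓ * P ^ e
    go D gain₁ gain₂ with D ≤? ∣ alive ∩ A x ∣
    -- Putting `x` into T kills at least D live vertices, so that branch runs with exponent `e ∸ D`.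
    -- Writing `e` as `e ∸ D + D` splits off `M ^ D` and `P ^ D`.
    go D gain₁ gain₂ | yes D≤ = subst Goal (m∸n+n≡m D≤e) large
      where
      open ≤-Reasoning
      Goal : ℕ → Set
      Goal e = (∑ ρ₁ f + ∑ ρ₀ f) * (S ^ suc ℓ * M ^ e) ≤ (2 * U) ^ suc ℓ * P ^ e
      D≤e : D ≤ e
      D≤e = ≤-trans D≤ (≤-trans (m+n≤o⇒n≤o ∣ alive ─ A x ∣ (≤-reflexive (∣p─q∣+∣p∩q∣≡∣p∣ alive (A x))))
        (m+n≤o⇒n≤o (K * k) e≥))
      e′≥ : K * k + ∣ alive ─ A x ∣ ≤ e ∸ D
      e′≥ = +-cancelʳ-≤ D _ _ (begin
        K * k + ∣ alive ─ A x ∣ + D                  ≤⟨ +-monoʳ-≤ _ D≤ ⟩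
        K * k + ∣ alive ─ A x ∣ + ∣ alive ∩ A x ∣    ≡⟨ +-assoc (K * k) _ _ ⟩
        K * k + (∣ alive ─ A x ∣ + ∣ alive ∩ A x ∣)  ≡⟨ cong (K * k +_) (∣p─q∣+∣p∩q∣≡∣p∣ alive (A x)) ⟩
        K * k + ∣ alive ∣                            ≤⟨ e≥ ⟩
        e                                            ≡⟨ m∸n+n≡m D≤e ⟨
        e ∸ D + D                                    ∎)
      bound₀ : ∑ ρ₀ f * (S ^ ℓ * M ^ (e ∸ D + D)) ≤ (2 * U) ^ ℓ * P ^ (e ∸ D + D)
      bound₀ = bound ℓ ρ₀ alive (e ∸ D + D) (freeᵇ false) (covers-[]≔ ρ x-free false cov)
        (≤-trans e≥ (≤-reflexive (sym (m∸n+n≡m D≤e))))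
      large : Goal (e ∸ D + D)
      large rewrite ^-distribˡ-+-* M (e ∸ D) D | ^-distribˡ-+-* P (e ∸ D) D =
        branch-step {F₀ = ∑ ρ₀ f} {F₁ = ∑ ρ₁ f} {a = S ^ ℓ} {b = M ^ (e ∸ D)} {c = (2 * U) ^ ℓ}
          {d = P ^ (e ∸ D)} {u = U} {s = S} gain₁
          (bound ℓ ρ₁ (alive ─ A x) (e ∸ D) (freeᵇ true) (covers-remove ρ x-free cov) e′≥)
          (subst₂ (λ s t → ∑ ρ₀ f * (S ^ ℓ * s) ≤ (2 * U) ^ ℓ * t)
            (^-distribˡ-+-* M (e ∸ D) D) (^-distribˡ-+-* P (e ∸ D) D) bound₀)
    go zero    gain₁ gain₂ | no D≰ = contradiction z≤n D≰
    -- Deciding `x` is itself the first of the D steps, and fewer than D live neighbours leave at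
    -- most J for the rest. The continuing branch is `x` outside T, hence the swapped sum.
    go (suc J) gain₁ gain₂ | no D≰ = conclude (suc J) {F = ∑ ρ₁ f + ∑ ρ₀ f} gain₂
      (subst (λ F → F * (S ^ suc ℓ * M ^ e) * (2 * U) ^ suc J + S ^ suc J * ((2 * U) ^ suc ℓ * P ^ e) ≤
                    (2 * S) ^ suc J * ((2 * U) ^ suc ℓ * P ^ e))
        (+-comm (∑ ρ₀ f) (∑ ρ₁ f))
        (chain-step {F₀ = ∑ ρ₁ f} {F₁ = ∑ ρ₀ f} {a = S ^ ℓ} {b = M ^ e} {c = (2 * U) ^ ℓ} {d = P ^ e} {h = 2 * U} {s = S}
          (^-monoˡ-≤ J (*-monoʳ-≤ 2 S≥U))
          (bound-uncovered ℓ J ρ₀ alive e x (freeᵇ false) (covers-[]≔ ρ x-free false cov) e≥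
            (lookup∘updateAt x ρ) other (≤-pred (≰⇒> D≰)))
          (bound ℓ ρ₁ (alive ─ A x) e (freeᵇ true) (covers-remove ρ x-free cov) (∣─∣≤ alive (A x) e≥))))

  bound-uncovered ℓ j ρ alive e x ℓ≡ cov e≥ x-false other ≤j with nonempty? (alive ∩ A x)
  bound-uncovered ℓ j ρ alive e x ℓ≡ cov e≥ x-false other ≤j | no empty
    rewrite uncovered⇒∑≡0 ρ alive x cov x-false (λ y y∈ y∈Ax → empty (y , x∈p∩q⁺ (y∈ , y∈Ax))) =
    *-monoˡ-≤ ((2 * U) ^ ℓ * P ^ e) (^-monoˡ-≤ j (m≤n*m S 2))
  bound-uncovered ℓ j ρ alive e x ℓ≡ cov e≥ x-false other ≤j | yes (y , y∈∩)
    with y∈ , y∈Ax ← x∈p∩q⁻ alive (A x) y∈∩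
    with z , z-free , y∈Az ← other y y∈ y∈Ax
    rewrite ∑-branch ρ z f z-free = go ℓ j ℓ≡ (<-≤-trans fewer ≤j)
    where
    ρ₀ ρ₁ : PartialAssignment n
    ρ₀ = ρ [ z ]≔ just false
    ρ₁ = ρ [ z ]≔ just true

    fewer : ∣ (alive ─ A z) ∩ A x ∣ < ∣ alive ∩ A x ∣
    fewer = p⊂q⇒∣p∣<∣q∣
      ( (λ w∈ → let w∈─ , w∈Ax = x∈p∩q⁻ (alive ─ A z) (A x) w∈ in x∈p∩q⁺ (p─q⊆p alive (A z) w∈─ , w∈Ax))
      , y , y∈∩ , λ y∈′ → x∈q⇒x∉p─q alive (A z) y∈Az (proj₁ (x∈p∩q⁻ (alive ─ A z) (A x) y∈′)))

    -- A surviving `w` is not adjacent to `z`, so its undecided neighbour differs from `z` and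
    -- remains undecided.
    other′ : ∀ w → w ∈ alive ─ A z → w ∈ A x → ∃ λ z′ → Free ρ₁ z′ × w ∈ A z′
    other′ w w∈ w∈Ax with z′ , z′-free , w∈Az′ ← other w (p─q⊆p alive (A z) w∈) w∈Ax =
      z′ , trans (lookup∘updateAt′ z′ z (λ { refl → x∈q⇒x∉p─q alive (A z) w∈Az′ w∈ }) ρ) z′-free , w∈Az′

    go : ∀ ℓ j → free ρ ≡ ℓ → ∣ (alive ─ A z) ∩ A x ∣ < j →
      (∑ ρ₁ f + ∑ ρ₀ f) * (S ^ ℓ * M ^ e) * (2 * U) ^ j + S ^ j * ((2 * U) ^ ℓ * P ^ e) ≤
        (2 * S) ^ j * ((2 * U) ^ ℓ * P ^ e)
    go zero    j       ℓ≡ _        = contradiction (trans (free-[]≔ ρ z true z-free) ℓ≡) λ ()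
    go (suc ℓ) (suc j) ℓ≡ (s≤s ≤j) =
      chain-step {F₀ = ∑ ρ₀ f} {F₁ = ∑ ρ₁ f} {a = S ^ ℓ} {b = M ^ e} {c = (2 * U) ^ ℓ} {d = P ^ e} {h = 2 * U} {s = S}
        (^-monoˡ-≤ j (*-monoʳ-≤ 2 S≥U))
        (bound-uncovered ℓ j ρ₁ (alive ─ A z) e x (freeᵇ true) (covers-remove ρ z-free cov) (∣─∣≤ alive (A z) e≥)
          (still-set ρ z-free true x x-false) other′ ≤j)
        (bound ℓ ρ₀ alive e (freeᵇ false) (covers-[]≔ ρ z-free false cov) e≥)
      where
      freeᵇ : ∀ b → free (ρ [ z ]≔ just b) ≡ ℓ
      freeᵇ b = suc-injective (trans (free-[]≔ ρ z b z-free) ℓ≡)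

-- Boolean tests and sums over all subsets.

all-elim : ∀ {A : Set} (p : A → Bool) {xs x} → all p xs ≡ true → x List∈.∈ xs → p x ≡ true
all-elim p {x ∷ xs} eq x∈ with p x in px
all-elim p {x ∷ xs} eq (here refl) | true = px
all-elim p {x ∷ xs} eq (there x∈)  | true = all-elim p eq x∈

all-intro : ∀ {A : Set} (p : A → Bool) xs → (∀ x → p x ≡ true) → all p xs ≡ true
all-intro p []       h = refl
all-intro p (x ∷ xs) h rewrite h x = all-intro p xs h

∧-elim : ∀ {a b} → a ∧ b ≡ true → a ≡ true × b ≡ true
∧-elim {true} {true} _ = refl , refl

∈-allSubsets : ∀ {N} (S : Subset N) → S List∈.∈ allSubsets N
∈-allSubsets []          = here refl
∈-allSubsets (true ∷ S)  = ∈-++⁺ˡ (∈-map⁺ (true ∷_) (∈-allSubsets S))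
∈-allSubsets (false ∷ S) = ∈-++⁺ʳ _ (∈-map⁺ (false ∷_) (∈-allSubsets S))

indicator : Bool → ℕ
indicator b = if b then 1 else 0

unassigned : ∀ n → PartialAssignment n
unassigned n = replicate n nothing

free-unassigned : ∀ n → free (unassigned n) ≡ n
free-unassigned zero    = refl
free-unassigned (suc n) = cong suc (free-unassigned n)

sum-allSubsets : ∀ {N} (f : Subset N → ℕ) → sum (map f (allSubsets N)) ≡ ∑ (unassigned N) f
sum-allSubsets {zero}  f = +-identityʳ (f [])
sum-allSubsets {suc N} f
  rewrite map-++ f (map (true ∷_) (allSubsets N)) (map (false ∷_) (allSubsets N))
        | sum-++ (map f (map (true ∷_) (allSubsets N))) (map f (map (false ∷_) (allSubsets N)))
  = cong₂ _+_ (half true) (half false)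
  where
  half : ∀ b → sum (map f (map (b ∷_) (allSubsets N))) ≡ ∑ (unassigned N) (f ∘ (b ∷_))
  half b = trans (cong sum (sym (map-∘ (allSubsets N)))) (sum-allSubsets (f ∘ (b ∷_)))

∑-++ : ∀ n {m} (f : Subset (n + m) → ℕ) →
  ∑ (unassigned (n + m)) f ≡ ∑ (unassigned n) (λ T → ∑ (unassigned m) (λ V → f (T ++ V)))
∑-++ zero    f = refl
∑-++ (suc n) f = cong₂ _+_ (∑-++ n (f ∘ (true ∷_))) (∑-++ n (f ∘ (false ∷_)))

∑-indicator-≤1 : ∀ {m} (p : Subset m → Bool) V₀ → (∀ V → p V ≡ true → V ≡ V₀) →
  ∑ (unassigned m) (indicator ∘ p) ≤ 1
∑-indicator-≤1 p [] unique with p []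
... | true  = ≤-refl
... | false = z≤n
∑-indicator-≤1 {suc m} p (b ∷ V₀) unique = split b unique
  where
  half≤1 : ∀ b → (∀ V → p V ≡ true → V ≡ b ∷ V₀) → ∑ (unassigned m) (indicator ∘ p ∘ (b ∷_)) ≤ 1
  half≤1 b unique = ∑-indicator-≤1 (p ∘ (b ∷_)) V₀ λ V pV → cong tail (unique (b ∷ V) pV)

  half≡0 : ∀ b b′ → b ≢ b′ → (∀ V → p V ≡ true → V ≡ b ∷ V₀) → ∑ (unassigned m) (indicator ∘ p ∘ (b′ ∷_)) ≡ 0
  half≡0 b b′ b≢b′ unique = ∑-zero (unassigned m) λ V _ →
    cong indicator (Bool.¬-not λ pV → b≢b′ (sym (cong head (unique (b′ ∷ V) pV))))

  split : ∀ b → (∀ V → p V ≡ true → V ≡ b ∷ V₀) →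
    ∑ (unassigned m) (indicator ∘ p ∘ (true ∷_)) + ∑ (unassigned m) (indicator ∘ p ∘ (false ∷_)) ≤ 1
  split true  unique
    rewrite half≡0 true false (λ ()) unique | +-identityʳ (∑ (unassigned m) (indicator ∘ p ∘ (true ∷_)))
    = half≤1 true unique
  split false unique rewrite half≡0 false true (λ ()) unique = half≤1 false unique

-- Maximal independent sets.

module _ {N} (G : Graph N) where

  independent-elim : ∀ S → independentᵇ G S ≡ true → ∀ u v →
    lookup S u ≡ true → lookup S v ≡ true → adj G u v ≡ false
  independent-elim S ind u v u∈ v∈
    with eq ← all-elim _ (all-elim _ ind (∈-allFin u)) (∈-allFin v)
    rewrite u∈ | v∈ with adj G u v
  ... | false = refl

  independent-intro : ∀ S → (∀ u v → lookup S u ≡ true → lookup S v ≡ true → adj G u v ≡ false) →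
    independentᵇ G S ≡ true
  independent-intro S h = all-intro _ (allFin N) λ u → all-intro _ (allFin N) (at u)
    where
    at : ∀ u v → not (lookup S u ∧ lookup S v ∧ adj G u v) ≡ true
    at u v with lookup S u in u∈ | lookup S v in v∈
    ... | false | _     = refl
    ... | true  | false = refl
    ... | true  | true  = cong not (h u v u∈ v∈)

  subset-elim : ∀ (S T : Subset N) → subsetᵇ S T ≡ true → ∀ u → lookup S u ≡ true → lookup T u ≡ true
  subset-elim S T sub u u∈ with eq ← all-elim _ sub (∈-allFin u) rewrite u∈ = eq

  subset-intro : ∀ (S T : Subset N) → (∀ u → lookup S u ≡ true → lookup T u ≡ true) → subsetᵇ S T ≡ true
  subset-intro S T h = all-intro _ (allFin N) at
    where
    at : ∀ u → not (lookup S u) ∨ lookup T u ≡ true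
    at u with lookup S u in u∈
    ... | false = refl
    ... | true  = h u u∈

  module _ (S : Subset N) (mi : maximalIndependentᵇ G S ≡ true) where

    maximal-independent : ∀ u v → lookup S u ≡ true → lookup S v ≡ true → adj G u v ≡ false
    maximal-independent = independent-elim S (proj₁ (∧-elim mi))

    -- Adding `v` to `S` keeps it independent, so by maximality `v` was in `S` already.
    maximal-saturated : ∀ v → (∀ u → lookup S u ≡ true → adj G v u ≡ false) → lookup S v ≡ true
    maximal-saturated v no-nbr = subset-elim S⁺ S (proj₁ (∧-elim same)) v (lookup∘updateAt v S)
      where
      S⁺ : Subset N
      S⁺ = S [ v ]≔ true

      S⊆S⁺ : ∀ u → lookup S u ≡ true → lookup S⁺ u ≡ true
      S⊆S⁺ u u∈ with u Fin.≟ v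
      ... | yes refl = lookup∘updateAt v S
      ... | no u≢v   = trans (lookup∘updateAt′ u v u≢v S) u∈

      independent⁺ : ∀ u w → lookup S⁺ u ≡ true → lookup S⁺ w ≡ true → adj G u w ≡ false
      independent⁺ u w u∈ w∈ with u Fin.≟ v | w Fin.≟ v
      ... | yes refl | yes refl = irrefl G u
      ... | yes refl | no w≢v   = no-nbr w (trans (sym (lookup∘updateAt′ w v w≢v S)) w∈)
      ... | no u≢v   | yes refl = trans (Graph.sym G u v) (no-nbr u (trans (sym (lookup∘updateAt′ u v u≢v S)) u∈))
      ... | no u≢v   | no w≢v   = maximal-independent u w
        (trans (sym (lookup∘updateAt′ u v u≢v S)) u∈) (trans (sym (lookup∘updateAt′ w v w≢v S)) w∈)

      same : sameᵇ S⁺ S ≡ true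
      same with eq ← all-elim _ (proj₂ (∧-elim {independentᵇ G S} mi)) (∈-allSubsets S⁺)
        rewrite subset-intro S S⁺ S⊆S⁺ | independent-intro S⁺ independent⁺ = eq

-- Traces and induced matchings of a bipartite graph.

module Bipartite {n} (G : Graph (n + 2 * n)) (bip : BipartiteXY n G) where

  cases : ∀ (Q : Fin (n + 2 * n) → Set) → (∀ x → Q (vX n x)) → (∀ y → Q (vY n y)) → ∀ u → Q u
  cases Q qX qY u with splitAt n u in eq
  ... | inj₁ x = subst Q (Fin.splitAt⁻¹-↑ˡ eq) (qX x)
  ... | inj₂ y = subst Q (Fin.splitAt⁻¹-↑ʳ eq) (qY y)

  A : Fin n → Subset (2 * n)
  A x = tabulate λ y → adj G (vX n x) (vY n y)

  ∈A⇒adj : ∀ {x y} → y ∈ A x → adj G (vX n x) (vY n y) ≡ true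
  ∈A⇒adj {x} {y} y∈ = trans (sym (lookup∘tabulate _ y)) ([]=⇒lookup y∈)

  adj⇒∈A : ∀ {x y} → adj G (vX n x) (vY n y) ≡ true → y ∈ A x
  adj⇒∈A {x} {y} eq = lookup⇒[]= y (A x) (trans (lookup∘tabulate _ y) eq)

  weight : Subset n → ℕ
  weight T = ∑ (unassigned (2 * n)) (λ V → indicator (maximalIndependentᵇ G (T ++ V)))

  mis≡∑weight : mis G ≡ ∑ (unassigned n) weight
  mis≡∑weight = trans (sum-allSubsets f) (∑-++ n f)
    where
    f : Subset (n + 2 * n) → ℕ
    f S = indicator (maximalIndependentᵇ G S)

  module _ (T : Subset n) where

    hasNeighbour? : ∀ y → Dec (∃ λ x → lookup T x ≡ true × adj G (vX n x) (vY n y) ≡ true)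
    hasNeighbour? y = Fin.any? λ x → (lookup T x Bool.≟ true) ×-dec (adj G (vX n x) (vY n y) Bool.≟ true)

    completion : Subset (2 * n)
    completion = tabulate λ y → does (¬? (hasNeighbour? y))

    -- Independence excludes each vertex of Y with a neighbour in `T`. Any other vertex of Y has no
    -- neighbour in `T ++ V`, as Y has no inner edges, and maximality includes it.
    completion-unique : ∀ V → maximalIndependentᵇ G (T ++ V) ≡ true → V ≡ completion
    completion-unique V mi = trans (sym (tabulate∘lookup V)) (tabulate-cong at)
      where
      at : ∀ y → lookup V y ≡ does (¬? (hasNeighbour? y))
      at y with hasNeighbour? y
      ... | yes (x , x∈T , xy) = Bool.¬-not λ y∈V → contradiction
        (trans (sym xy) (maximal-independent G (T ++ V) mi (vX n x) (vY n y)
          (trans (lookup-++ˡ T V x) x∈T) (trans (lookup-++ʳ T V y) y∈V))) λ ()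
      ... | no ∄x = trans (sym (lookup-++ʳ T V y)) (maximal-saturated G (T ++ V) mi (vY n y) (cases _
        (λ x x∈ → Bool.¬-not λ yx → ∄x (x , trans (sym (lookup-++ˡ T V x)) x∈ , trans (Graph.sym G _ _) yx))
        (λ y′ _ → proj₂ bip y y′)))

  weight≤1 : ∀ T → weight T ≤ 1
  weight≤1 T = ∑-indicator-≤1 _ (completion T) (completion-unique T)

  -- Every neighbour of `x` is adjacent to `T`, so independence keeps it out of the set. Then
  -- nothing prevents adding `x`, against maximality.
  weight-support : ∀ T x → lookup T x ≡ false →
    (∀ y → y ∈ A x → ∃ λ z → lookup T z ≡ true × y ∈ A z) → weight T ≡ 0
  weight-support T x x∉T hit = ∑-zero (unassigned (2 * n)) λ V _ → cong indicator (Bool.¬-not (absurd V))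
    where
    absurd : ∀ V → ¬ maximalIndependentᵇ G (T ++ V) ≡ true
    absurd V mi = contradiction (trans (sym x∉T) (trans (sym (lookup-++ˡ T V x))
      (maximal-saturated G (T ++ V) mi (vX n x) (cases _ (λ x′ _ → proj₁ bip x x′) no-nbr)))) λ ()
      where
      no-nbr : ∀ y → lookup (T ++ V) (vY n y) ≡ true → adj G (vX n x) (vY n y) ≡ false
      no-nbr y y∈ = Bool.¬-not λ xy → let z , z∈T , y∈Az = hit y (adj⇒∈A xy) in
        contradiction (trans (sym (∈A⇒adj y∈Az)) (maximal-independent G (T ++ V) mi (vX n z) (vY n y)
          (trans (lookup-++ˡ T V z) z∈T) y∈)) λ ()

  -- The cross condition also gives injectivity: two indices sharing an endpoint would produce a
  -- cross edge. Inside X and inside Y there are no edges to exclude.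
  matching⇒induced : ∀ j (xs : Fin j → Fin n) (ys : Fin j → Fin (2 * n)) →
    (∀ i → ys i ∈ A (xs i)) → (∀ i i′ → ys i ∈ A (xs i′) → i′ ≡ i) →
    ∃ λ (m : Fin j ⊎ Fin j → Fin (n + 2 * n)) → IsInducedMatching G j m
  matching⇒induced j xs ys edge cross = m , injective , induced
    where
    m : Fin j ⊎ Fin j → Fin (n + 2 * n)
    m (inj₁ i) = vX n (xs i)
    m (inj₂ i) = vY n (ys i)

    X≢Y : ∀ i i′ → vX n (xs i) ≢ vY n (ys i′)
    X≢Y i i′ eq = contradiction
      (trans (sym (∈A⇒adj (edge i))) (trans (cong (λ u → adj G u (vY n (ys i))) eq) (proj₂ bip _ _))) λ ()

    injective : ∀ {p q} → m p ≡ m q → p ≡ q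
    injective {inj₁ i} {inj₁ i′} eq = cong inj₁ (sym (cross i i′
      (subst (λ x → ys i ∈ A x) (Fin.↑ˡ-injective (2 * n) _ _ eq) (edge i))))
    injective {inj₂ i} {inj₂ i′} eq = cong inj₂ (cross i′ i
      (subst (_∈ A (xs i)) (Fin.↑ʳ-injective n _ _ eq) (edge i)))
    injective {inj₁ i} {inj₂ i′} eq = contradiction eq (X≢Y i i′)
    injective {inj₂ i} {inj₁ i′} eq = contradiction (sym eq) (X≢Y i′ i)

    induced : ∀ p q → (adj G (m p) (m q) ≡ true → Partner p q) × (Partner p q → adj G (m p) (m q) ≡ true)
    induced (inj₁ i) (inj₁ i′) = (λ e → contradiction (trans (sym e) (proj₁ bip _ _)) λ ()) , λ ()
    induced (inj₂ i) (inj₂ i′) = (λ e → contradiction (trans (sym e) (proj₂ bip _ _)) λ ()) , λ ()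
    induced (inj₁ i) (inj₂ i′) = (λ e → cross i′ i (adj⇒∈A e)) , λ { refl → ∈A⇒adj (edge i) }
    induced (inj₂ i) (inj₁ i′) = (λ e → sym (cross i i′ (adj⇒∈A (trans (Graph.sym G _ _) e)))) ,
      λ { refl → trans (Graph.sym G _ _) (∈A⇒adj (edge i)) }

  matching-bound : ∀ k → (∀ j m → IsInducedMatching G j m → j ≤ k) →
    ∀ j (xs : Fin j → Fin n) (ys : Fin j → Fin (2 * n)) →
    (∀ i → ys i ∈ A (xs i)) → (∀ i i′ → ys i ∈ A (xs i′) → i′ ≡ i) → j ≤ k
  matching-bound k im≤k j xs ys edge cross = im≤k j _ (proj₂ (matching⇒induced j xs ys edge cross))

  mis-bound : ∀ k → (∀ j m → IsInducedMatching G j m → j ≤ k) →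
    ∀ M P K D → .{{_ : NonZero M}} → M ≤ P →
    P ^ K * (M ^ D + P ^ D) ≤ 2 * M ^ K * P ^ D →
    (2 * P ^ K) ^ D ≤ (2 * M ^ K) ^ D + (P ^ K) ^ D →
    mis G * ((P ^ K) ^ n * M ^ (K * k + 2 * n)) ≤ (2 * M ^ K) ^ n * P ^ (K * k + 2 * n)
  mis-bound k im≤k M P K D M≤P gain₁ gain₂ rewrite mis≡∑weight =
    -- At the start nothing in X is decided and all of Y is live.
    bound n (unassigned n) ⊤ (K * k + 2 * n) (free-unassigned n) (λ y y∉ → contradiction ∈⊤ y∉)
      (≤-reflexive (cong (K * k +_) (∣⊤∣≡n (2 * n))))
    where
    open Counting A weight weight≤1 weight-support k (matching-bound k im≤k) M P K D M≤P gain₁ gain₂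

-- Bernoulli estimates and the choice of parameters.

module _ (M : ℕ) where
  private
    P = suc M

  -- Bernoulli's inequality 1 - E/P ≤ (1 - 1/P)^E, cleared of denominators.
  bernoulli-upper : ∀ E → P ^ E * P ≤ M ^ E * P + E * P ^ E
  bernoulli-upper zero    = m≤m+n _ _
  bernoulli-upper (suc E) = begin
    P * P ^ E * P                              ≡⟨ *-assoc P (P ^ E) P ⟩
    P * (P ^ E * P)                            ≤⟨ *-monoʳ-≤ P (bernoulli-upper E) ⟩
    P * (M ^ E * P + E * P ^ E)                ≡⟨ expand M (M ^ E) E (P ^ E) ⟩
    M ^ E * P + (M * M ^ E * P + E * (P * P ^ E)) ≤⟨ +-monoˡ-≤ _
                                                  (≤-trans (*-monoˡ-≤ P (^-monoˡ-≤ E (n≤1+n M))) (≤-reflexive (*-comm (P ^ E) P))) ⟩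
    P * P ^ E + (M * M ^ E * P + E * (P * P ^ E)) ≡⟨ collect (P * P ^ E) (M * M ^ E * P) (E * (P * P ^ E)) ⟩
    M * M ^ E * P + suc E * (P * P ^ E)        ∎
    where
    open ≤-Reasoning
    expand : ∀ M x E y → suc M * (x * suc M + E * y) ≡ x * suc M + (M * x * suc M + E * (suc M * y))
    expand = solve-∀
    collect : ∀ a b c → a + (b + c) ≡ b + (a + c)
    collect = solve-∀

  -- Bernoulli's inequality 1 + E/M ≤ (1 + 1/M)^E, cleared of denominators.
  bernoulli-lower : ∀ E → M ^ E * (M + E) ≤ P ^ E * M
  bernoulli-lower zero    = ≤-reflexive (cong (1 *_) (+-identityʳ M))
  bernoulli-lower (suc E) = begin
    M * M ^ E * (M + suc E)              ≤⟨ m≤m+n _ (M ^ E * E) ⟩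
    M * M ^ E * (M + suc E) + M ^ E * E  ≡⟨ factor M (M ^ E) E ⟩
    P * (M ^ E * (M + E))                ≤⟨ *-monoʳ-≤ P (bernoulli-lower E) ⟩
    P * (P ^ E * M)                      ≡⟨ *-assoc P (P ^ E) M ⟨
    P * P ^ E * M                        ∎
    where
    open ≤-Reasoning
    factor : ∀ M x E → M * x * (M + suc E) + x * E ≡ suc M * (x * (M + E))
    factor = solve-∀

  2*M^M≤P^M : .{{NonZero M}} → 2 * M ^ M ≤ P ^ M
  2*M^M≤P^M = *-cancelʳ-≤ (2 * M ^ M) (P ^ M) M (begin
    2 * M ^ M * M     ≡⟨ double (M ^ M) M ⟩
    M ^ M * (M + M)   ≤⟨ bernoulli-lower M ⟩
    P ^ M * M         ∎)
    where
    open ≤-Reasoning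
    double : ∀ x M → 2 * x * M ≡ x * (M + M)
    double = solve-∀

  -- For positive `c` this is (M/P)^E ≥ 1 - 1/c. It serves `gain₂` with c = 2^D and E = KD, and
  -- `gain₁` with c = 3 and E = K.
  scaled-gain : ∀ c E → c * E ≤ P → c * P ^ E ≤ c * M ^ E + P ^ E
  scaled-gain c E cE≤P = *-cancelʳ-≤ _ _ P (begin
    c * P ^ E * P                      ≡⟨ *-assoc c (P ^ E) P ⟩
    c * (P ^ E * P)                    ≤⟨ *-monoʳ-≤ c (bernoulli-upper E) ⟩
    c * (M ^ E * P + E * P ^ E)        ≡⟨ expand c (M ^ E) P E (P ^ E) ⟩
    c * M ^ E * P + c * E * P ^ E      ≤⟨ +-monoʳ-≤ _ (*-monoˡ-≤ (P ^ E) cE≤P) ⟩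
    c * M ^ E * P + P * P ^ E          ≡⟨ collect c (M ^ E) P (P ^ E) ⟩
    (c * M ^ E + P ^ E) * P            ∎)
    where
    open ≤-Reasoning
    expand : ∀ c m P E p → c * (m * P + E * p) ≡ c * m * P + c * E * p
    expand = solve-∀
    collect : ∀ c m P p → c * m * P + P * p ≡ (c * m + p) * P
    collect = solve-∀

-- With t = u/s the claim is t³ + 1 ≤ 2t, that is (1 - t)(t² + t - 1) ≥ 0. It holds from t = (√5 -
-- 1)/2 ≈ 0.618 up to 1, and here 2/3 ≤ t ≤ 1.
cubic : ∀ {u s} → u ≤ s → 2 * s ≤ 3 * u → s * (u ^ 3 + s ^ 3) ≤ 2 * u * s ^ 3
cubic {u} u≤s 2s≤3u with δ , refl ← m≤n⇒∃[o]m+o≡n u≤s =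
  with-slack (m≤n⇒∃[o]m+o≡n (+-cancelˡ-≤ (2 * u) _ _ (subst₂ _≤_ (*-distribˡ-+ 2 u δ) (+-comm u (2 * u)) 2s≤3u)))
  where
  Goal : ℕ → Set
  Goal u = (u + δ) * (u ^ 3 + (u + δ) ^ 3) ≤ 2 * u * (u + δ) ^ 3
  -- `2 * s ≤ 3 * u` means 2δ ≤ u. After substituting u = 2δ + τ, the difference of the two sides
  -- has no negative coefficient.
  identity : ∀ δ τ → let u = 2 * δ + τ ; s = u + δ in
    s * (u * (u * (u * 1)) + s * (s * (s * 1))) + s * (δ * δ * δ + 3 * (δ * δ * τ) + δ * τ * τ) ≡
      2 * u * (s * (s * (s * 1)))
  identity = solve-∀
  with-slack : ∃ (λ τ → 2 * δ + τ ≡ u) → Goal u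
  with-slack (τ , eq) = subst Goal eq (≤-trans (m≤m+n _ _) (≤-reflexive (identity δ τ)))

module Parameters (K : ℕ) where

  -- M is chosen so that 2 ^ D * (K * D) ≤ P in the Bernoulli estimate P^(KD) ≤ M^(KD) + KD * P^(KD−1).
  D M P : ℕ
  D = K * 3
  M = 2 ^ D * (K * D)
  P = suc M

  instance
    M≢0 : .{{NonZero K}} → NonZero M
    M≢0 = m*n≢0 (2 ^ D) (K * D) {{m^n≢0 2 D}} {{m*n≢0 K D {{it}} {{m*n≢0 K 3}}}}

  gain₂ : (2 * P ^ K) ^ D ≤ (2 * M ^ K) ^ D + (P ^ K) ^ D
  gain₂ rewrite ^-distribʳ-* 2 (P ^ K) D | ^-distribʳ-* 2 (M ^ K) D | ^-*-assoc P K D | ^-*-assoc M K D =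
    scaled-gain M (2 ^ D) (K * D) (n≤1+n M)

  -- The choice D = 3K turns `M ^ D` and `P ^ D` into cubes of `M ^ K` and `P ^ K`.
  gain₁ : .{{NonZero K}} → P ^ K * (M ^ D + P ^ D) ≤ 2 * M ^ K * P ^ D
  gain₁ = subst₂ (λ m p → P ^ K * (m + p) ≤ 2 * M ^ K * p) (^-*-assoc M K 3) (^-*-assoc P K 3)
    (cubic (^-monoˡ-≤ K (n≤1+n M)) (+-cancelʳ-≤ (P ^ K) _ _ (begin
      2 * P ^ K + P ^ K    ≡⟨ +-comm (2 * P ^ K) (P ^ K) ⟩
      3 * P ^ K            ≤⟨ scaled-gain M 3 K 3K≤P ⟩
      3 * M ^ K + P ^ K    ∎)))
    where
    open ≤-Reasoning
    3K≤P : 3 * K ≤ P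
    3K≤P = begin
      3 * K             ≡⟨ *-comm 3 K ⟩
      D                 ≤⟨ m≤n*m D K ⟩
      K * D             ≤⟨ m≤n*m (K * D) (2 ^ D) {{m^n≢0 2 D}} ⟩
      M                 ≤⟨ n≤1+n M ⟩
      P                 ∎

-- From the counting bound to the logarithmic deficit.

cancel-powers : ∀ {F X} M P b c .{{_ : NonZero M}} .{{_ : NonZero P}} →
  F * (P ^ (b + c) * M ^ b) ≤ X * (M ^ (b + c) * P ^ b) → F * P ^ c ≤ X * M ^ c
cancel-powers {F} {X} M P b c h = *-cancelʳ-≤ _ _ (P ^ b * M ^ b) {{m*n≢0 _ _ {{m^n≢0 P b}} {{m^n≢0 M b}}}} (begin
  F * P ^ c * (P ^ b * M ^ b)     ≡⟨ l F (P ^ c) (P ^ b) (M ^ b) ⟩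
  F * (P ^ b * P ^ c * M ^ b)     ≡⟨ cong (λ t → F * (t * M ^ b)) (^-distribˡ-+-* P b c) ⟨
  F * (P ^ (b + c) * M ^ b)       ≤⟨ h ⟩
  X * (M ^ (b + c) * P ^ b)       ≡⟨ cong (λ t → X * (t * P ^ b)) (^-distribˡ-+-* M b c) ⟩
  X * (M ^ b * M ^ c * P ^ b)     ≡⟨ r X (M ^ c) (M ^ b) (P ^ b) ⟩
  X * M ^ c * (P ^ b * M ^ b)     ∎)
  where
  open ≤-Reasoning
  l : ∀ F c p m → F * c * (p * m) ≡ F * (p * c * m)
  l = solve-∀
  r : ∀ X c m p → X * (m * c * p) ≡ X * c * (p * m)
  r = solve-∀

-- For q = n - k the hypothesis says rq > n, and Kq = 2rq + q. The part 2rq pays for the 2n vertices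
-- of Y, and the last q, which is the reason for the 1 in K, keeps c above n/r.
surplus : ∀ r n k → r * k + n < r * n → let K = suc (2 * r) in
  ∃ λ c → ∃ λ y → K * n ≡ (K * k + 2 * n) + c × c * r ≡ n + suc y
surplus r n k h with g , eq ← m≤n⇒∃[o]m+o≡n h
  with q , refl ← m≤n⇒∃[o]m+o≡n (<⇒≤ (*-cancelˡ-< r k n (≤-<-trans (m≤m+n _ n) h)))
  = 2 * suc g + q , 2 * r * suc g + g , split , scaled
  where
  rq : r * q ≡ suc (k + q + g)
  rq = sym (+-cancelˡ-≡ (r * k) _ _ (trans (assoc (r * k) (k + q) g) (trans eq (*-distribˡ-+ r k q))))
    where
    assoc : ∀ a b g → a + suc (b + g) ≡ suc (a + b) + g
    assoc = solve-∀
  split : suc (2 * r) * (k + q) ≡ (suc (2 * r) * k + 2 * (k + q)) + (2 * suc g + q)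
  split = trans (l r k q) (trans (cong (λ t → k + q + 2 * (r * k) + 2 * t) rq) (r′ r k q g))
    where
    l : ∀ r k q → suc (2 * r) * (k + q) ≡ k + q + 2 * (r * k) + 2 * (r * q)
    l = solve-∀
    r′ : ∀ r k q g → k + q + 2 * (r * k) + 2 * suc (k + q + g) ≡ (suc (2 * r) * k + 2 * (k + q)) + (2 * suc g + q)
    r′ = solve-∀
  scaled : (2 * suc g + q) * r ≡ k + q + suc (2 * r * suc g + g)
  scaled = trans (l g q r) (trans (cong (2 * r * suc g +_) rq) (r′ r g (k + q)))
    where
    l : ∀ g q r → (2 * suc g + q) * r ≡ 2 * r * suc g + r * q
    l = solve-∀
    r′ : ∀ r g n → 2 * r * suc g + suc (n + g) ≡ n + suc (2 * r * suc g + g)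
    r′ = solve-∀

-- The bound is F ≤ 2^n (M/P)^c with c > n/r. Its r-th power gains more than (M/P)^n, and the M-th
-- power of that gains 2^(-n) because (P/M)^M ≥ 2. Hence log F < (1 - 1/(rM)) n.
amplify : ∀ {F} r M n k .{{_ : NonZero M}} → r * k + n < r * n → let K = suc (2 * r) ; P = suc M in
  F * ((P ^ K) ^ n * M ^ (K * k + 2 * n)) ≤ (2 * M ^ K) ^ n * P ^ (K * k + 2 * n) →
  F ^ (r * M) * 2 ^ n < 2 ^ (r * M * n)
amplify {F} r M n k h bound with c , y , Kn≡ , cr≡ ← surplus r n k h =
  *-cancelʳ-< ((M ^ n) ^ M) _ _ (begin-strict
    F ^ (r * M) * 2 ^ n * (M ^ n) ^ M   ≡⟨ regroup ⟩
    (F ^ r) ^ M * (2 * M ^ M) ^ n       ≤⟨ *-monoʳ-≤ ((F ^ r) ^ M) (^-monoˡ-≤ n (2*M^M≤P^M M)) ⟩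
    (F ^ r) ^ M * (P ^ M) ^ n           ≡⟨ cong ((F ^ r) ^ M *_) (^-swap P M n) ⟩
    (F ^ r) ^ M * (P ^ n) ^ M           ≡⟨ ^-distribʳ-* (F ^ r) (P ^ n) M ⟨
    (F ^ r * P ^ n) ^ M                 <⟨ ^-monoˡ-< M strict-power ⟩
    ((2 ^ n) ^ r * M ^ n) ^ M           ≡⟨ ^-distribʳ-* ((2 ^ n) ^ r) (M ^ n) M ⟩
    ((2 ^ n) ^ r) ^ M * (M ^ n) ^ M     ≡⟨ cong (_* (M ^ n) ^ M) exponents ⟩
    2 ^ (r * M * n) * (M ^ n) ^ M       ∎)
  where
  open ≤-Reasoning
  K = suc (2 * r)
  P = suc M
  b = K * k + 2 * n

  ^-swap : ∀ m i j → (m ^ i) ^ j ≡ (m ^ j) ^ i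
  ^-swap m i j = trans (^-*-assoc m i j) (trans (cong (m ^_) (*-comm i j)) (sym (^-*-assoc m j i)))

  exponents : ((2 ^ n) ^ r) ^ M ≡ 2 ^ (r * M * n)
  exponents = trans (cong (_^ M) (^-*-assoc 2 n r)) (trans (^-*-assoc 2 (n * r) M) (cong (2 ^_) (e n r M)))
    where
    e : ∀ n r M → n * r * M ≡ r * M * n
    e = solve-∀

  regroup : F ^ (r * M) * 2 ^ n * (M ^ n) ^ M ≡ (F ^ r) ^ M * (2 * M ^ M) ^ n
  regroup = trans (*-assoc (F ^ (r * M)) _ _) (cong₂ _*_ (sym (^-*-assoc F r M))
    (trans (cong (2 ^ n *_) (^-swap M n M)) (sym (^-distribʳ-* 2 (M ^ M) n))))

  cancelled : F * P ^ c ≤ 2 ^ n * M ^ c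
  cancelled = cancel-powers {F} {2 ^ n} M P b c (begin
    F * (P ^ (b + c) * M ^ b)          ≡⟨ cong (λ t → F * (P ^ t * M ^ b)) Kn≡ ⟨
    F * (P ^ (K * n) * M ^ b)          ≡⟨ cong (λ t → F * (t * M ^ b)) (^-*-assoc P K n) ⟨
    F * ((P ^ K) ^ n * M ^ b)          ≤⟨ bound ⟩
    (2 * M ^ K) ^ n * P ^ b            ≡⟨ cong (_* P ^ b) (^-distribʳ-* 2 (M ^ K) n) ⟩
    2 ^ n * (M ^ K) ^ n * P ^ b        ≡⟨ *-assoc (2 ^ n) _ _ ⟩
    2 ^ n * ((M ^ K) ^ n * P ^ b)      ≡⟨ cong (λ t → 2 ^ n * (t * P ^ b)) (trans (^-*-assoc M K n) (cong (M ^_) Kn≡)) ⟩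
    2 ^ n * (M ^ (b + c) * P ^ b)      ∎)

  power : ∀ m → (m ^ c) ^ r ≡ m ^ n * m ^ suc y
  power m = trans (^-*-assoc m c r) (trans (cong (m ^_) cr≡) (^-distribˡ-+-* m n (suc y)))

  -- Since cr = n + suc y, a positive power `suc y` is left over, and M < P makes the inequality
  -- strict.
  strict-power : F ^ r * P ^ n < (2 ^ n) ^ r * M ^ n
  strict-power = *-cancelʳ-< (P ^ suc y) _ _ (begin-strict
    F ^ r * P ^ n * P ^ suc y               ≡⟨ *-assoc (F ^ r) _ _ ⟩
    F ^ r * (P ^ n * P ^ suc y)             ≡⟨ cong (F ^ r *_) (power P) ⟨
    F ^ r * (P ^ c) ^ r                     ≡⟨ ^-distribʳ-* F (P ^ c) r ⟨
    (F * P ^ c) ^ r                         ≤⟨ ^-monoˡ-≤ r cancelled ⟩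
    (2 ^ n * M ^ c) ^ r                     ≡⟨ ^-distribʳ-* (2 ^ n) (M ^ c) r ⟩
    (2 ^ n) ^ r * (M ^ c) ^ r               ≡⟨ cong ((2 ^ n) ^ r *_) (power M) ⟩
    (2 ^ n) ^ r * (M ^ n * M ^ suc y)       ≡⟨ *-assoc ((2 ^ n) ^ r) _ _ ⟨
    (2 ^ n) ^ r * M ^ n * M ^ suc y         <⟨ *-monoʳ-< _ {{m*n≢0 _ _ {{m^n≢0 (2 ^ n) r {{m^n≢0 2 n}}}} {{m^n≢0 M n}}}}
                                                  (^-monoˡ-< (suc y) (n<1+n M)) ⟩
    (2 ^ n) ^ r * M ^ n * P ^ suc y         ∎)

-- The size of δ and the theorem.

n<2^n : ∀ n → n < 2 ^ n
n<2^n zero    = s≤s z≤n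
n<2^n (suc n) = +-mono-≤ (m^n>0 2 n) (≤-trans (n<2^n n) (m≤m+n _ 0))

-- Since δ will be 1/(rM), this makes it at least 2^(-16r). Each of the five factors is bounded by a
-- power of 2, with exponents r + 9r + 2r + 2r + 2r = 16r.
rM≤2^16r : ∀ r .{{_ : NonZero r}} → r * Parameters.M (suc (2 * r)) ≤ 2 ^ (16 * r)
rM≤2^16r r = begin
  r * (2 ^ (K * 3) * (K * (K * 3)))
    ≤⟨ *-mono-≤ (<⇒≤ (n<2^n r)) (*-mono-≤ (^-monoʳ-≤ 2 K*3≤9r) (*-mono-≤ K≤ (*-mono-≤ K≤ 3≤))) ⟩
  2 ^ r * (2 ^ (9 * r) * (2 ^ (2 * r) * (2 ^ (2 * r) * 2 ^ (2 * r))))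
    ≡⟨ combine ⟩
  2 ^ (16 * r) ∎
  where
  open ≤-Reasoning
  K = suc (2 * r)
  K≤ : K ≤ 2 ^ (2 * r)
  K≤ = n<2^n (2 * r)
  3≤K : 3 ≤ K
  3≤K = s≤s (*-monoʳ-≤ 2 (>-nonZero⁻¹ r))
  3≤ : 3 ≤ 2 ^ (2 * r)
  3≤ = ≤-trans 3≤K K≤
  K*3≤9r : K * 3 ≤ 9 * r
  K*3≤9r = subst₂ _≤_ (l r) (r′ r) (+-monoʳ-≤ (6 * r) (*-monoʳ-≤ 3 (>-nonZero⁻¹ r)))
    where
    l : ∀ r → 6 * r + 3 * 1 ≡ suc (2 * r) * 3
    l = solve-∀
    r′ : ∀ r → 6 * r + 3 * r ≡ 9 * r
    r′ = solve-∀
  combine : 2 ^ r * (2 ^ (9 * r) * (2 ^ (2 * r) * (2 ^ (2 * r) * 2 ^ (2 * r)))) ≡ 2 ^ (16 * r)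
  combine
    rewrite sym (^-distribˡ-+-* 2 (2 * r) (2 * r)) | sym (^-distribˡ-+-* 2 (2 * r) (2 * r + 2 * r))
          | sym (^-distribˡ-+-* 2 (9 * r) (2 * r + (2 * r + 2 * r)))
          | sym (^-distribˡ-+-* 2 r (9 * r + (2 * r + (2 * r + 2 * r)))) = cong (2 ^_) (e r)
    where
    e : ∀ r → r + (9 * r + (2 * r + (2 * r + 2 * r))) ≡ 16 * r
    e = solve-∀

-- Applying the hypothesis on induced matchings to this one shows that its right side is large
-- enough for some k.
empty-matching : ∀ {N} (G : Graph N) → IsInducedMatching G 0 λ { (inj₁ ()) ; (inj₂ ()) }
empty-matching G = (λ { {inj₁ ()} ; {inj₂ ()} }) , λ { (inj₁ ()) ; (inj₂ ()) }

mis-deficit : ∀ r .{{_ : NonZero r}} n (G : Graph (n + 2 * n)) → BipartiteXY n G →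
  (∀ j m → IsInducedMatching G j m → r * j + n < r * n) →
  let M = Parameters.M (suc (2 * r)) in mis G ^ (r * M) * 2 ^ n < 2 ^ (r * M * n)
mis-deficit r n G bip im< = amplify r M n k k<
  (Bipartite.mis-bound G bip k im≤k M P K D (n≤1+n M) gain₁ gain₂)
  where
  K = suc (2 * r)
  open Parameters K
  -- The largest k with rk + n < rn. It bounds im(G) without computing it.
  k : ℕ
  k = (r * n ∸ suc n) / r

  im≤k : ∀ j m → IsInducedMatching G j m → j ≤ k
  im≤k j m induced = subst (_≤ k) (m*n/n≡m j r) (/-monoˡ-≤ r
    (m+n≤o⇒m≤o∸n (j * r) (subst (_≤ r * n)
      (trans (cong (λ t → suc (t + n)) (*-comm r j)) (sym (+-suc (j * r) n))) (im< j m induced))))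

  k< : r * k + n < r * n
  k< = begin-strict
    r * k + n            ≡⟨ cong (_+ n) (*-comm r k) ⟩
    k * r + n            <⟨ n<1+n _ ⟩
    suc (k * r + n)      ≡⟨ +-suc (k * r) n ⟨
    k * r + suc n        ≤⟨ +-monoˡ-≤ (suc n) (m/n*n≤m (r * n ∸ suc n) r) ⟩
    r * n ∸ suc n + suc n ≡⟨ m∸n+n≡m (subst (λ t → t + n < r * n) (*-zeroʳ r) (im< 0 _ (empty-matching G))) ⟩
    r * n                ∎
    where open ≤-Reasoning

-- Replaces ε = a/b by the unit fraction 1/r ≤ a/b.
rescale-deficit : ∀ {a b} r .{{_ : NonZero r}} j n → b ≤ r * a → b * j + a * n < b * n → r * j + n < r * n
rescale-deficit {a} {b} r j n b≤ra h = *-cancelˡ-< b _ _ (begin-strict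
  b * (r * j + n)          ≡⟨ l b r j n ⟩
  r * (b * j) + b * n      ≤⟨ +-monoʳ-≤ (r * (b * j)) (*-monoˡ-≤ n b≤ra) ⟩
  r * (b * j) + r * a * n  ≡⟨ m b r j a n ⟩
  r * (b * j + a * n)      <⟨ *-monoʳ-< r h ⟩
  r * (b * n)              ≡⟨ swap r b n ⟩
  b * (r * n)              ∎)
  where
  open ≤-Reasoning
  l : ∀ b r j n → b * (r * j + n) ≡ r * (b * j) + b * n
  l = solve-∀
  m : ∀ b r j a n → r * (b * j) + r * a * n ≡ r * (b * j + a * n)
  m = solve-∀
  swap : ∀ r b n → r * (b * n) ≡ b * (r * n)
  swap = solve-∀

theorem1p5 : Σ ℕ λ c → Σ ℕ λ d → 0 < c × 0 < d ×
    ((a b : ℕ) → 0 < a → 0 < b →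
    Σ ℕ λ u → Σ ℕ λ v → 0 < v ×
    v ^ (d * a) ≤ u ^ (d * a) * 2 ^ (c * b) ×
    ((n : ℕ) (G : Graph (n + 2 * n)) → BipartiteXY n G →
    ((k : ℕ) (M : Fin k ⊎ Fin k → Fin (n + 2 * n)) →
    IsInducedMatching G k M → b * k + a * n < b * n) →
    mis G ^ v * 2 ^ (u * n) < 2 ^ (v * n)))
-- With ε = a/b, δ = u/v and C = c/d, the constant is C = 32 = 16 · 2: rM ≤ 2^(16r), and r ≤ 2/ε
-- when ε ≤ 1.
theorem1p5 = 32 , 1 , z<s , z<s , δ
  where
  δ : (a b : ℕ) → 0 < a → 0 < b → Σ ℕ λ u → Σ ℕ λ v → 0 < v ×
    v ^ (1 * a) ≤ u ^ (1 * a) * 2 ^ (32 * b) ×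
    ((n : ℕ) (G : Graph (n + 2 * n)) → BipartiteXY n G →
    ((k : ℕ) (M : Fin k ⊎ Fin k → Fin (n + 2 * n)) →
    IsInducedMatching G k M → b * k + a * n < b * n) →
    mis G ^ v * 2 ^ (u * n) < 2 ^ (v * n))
  δ a b 0<a 0<b with a ≤? b
  -- For ε > 1 the empty matching already contradicts the hypothesis, so δ = 1 will do.
  ... | no a≰b = 1 , 1 , z<s , m≤m*n (1 ^ (1 * a)) (2 ^ (32 * b)) {{m^n≢0 2 (32 * b)}} , λ n G bip im< →
    contradiction (*-monoˡ-≤ n (<⇒≤ (≰⇒> a≰b)))
      (<⇒≱ (≤-<-trans (m≤n+m (a * n) (b * 0)) (im< 0 _ (empty-matching G))))
  ... | yes a≤b = 1 , r * M , >-nonZero⁻¹ (r * M) , size , λ n G bip im< →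
    subst (λ t → mis G ^ (r * M) * 2 ^ t < 2 ^ (r * M * n)) (sym (*-identityˡ n))
      (mis-deficit r n G bip λ j m induced → rescale-deficit r j n b≤ra (im< j m induced))
    where
    open ≤-Reasoning
    instance
      a≢0 : NonZero a
      a≢0 = >-nonZero 0<a
    -- Rounding 1/ε up in this way gives 1/ε ≤ r ≤ 1/ε + 1, and a ≤ b bounds the latter by 2/ε.
    r = suc (b / a)
    M = Parameters.M (suc (2 * r))
    instance
      rM≢0 : NonZero (r * M)
      rM≢0 = m*n≢0 r M {{_}} {{Parameters.M≢0 (suc (2 * r))}}
    b≤ra : b ≤ r * a
    b≤ra = begin
      b                    ≡⟨ m≡m%n+[m/n]*n b a ⟩
      b % a + b / a * a    ≤⟨ +-monoˡ-≤ (b / a * a) (<⇒≤ (m%n<n b a)) ⟩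
      r * a                ∎
    ra≤2b : r * a ≤ 2 * b
    ra≤2b = +-mono-≤ a≤b (≤-trans (m/n*n≤m b a) (m≤m+n b 0))
    size : (r * M) ^ (1 * a) ≤ 1 ^ (1 * a) * 2 ^ (32 * b)
    size = begin
      (r * M) ^ (1 * a)           ≡⟨ cong ((r * M) ^_) (*-identityˡ a) ⟩
      (r * M) ^ a                 ≤⟨ ^-monoˡ-≤ a (rM≤2^16r r) ⟩
      (2 ^ (16 * r)) ^ a          ≡⟨ ^-*-assoc 2 (16 * r) a ⟩
      2 ^ (16 * r * a)            ≤⟨ ^-monoʳ-≤ 2 (≤-trans (≤-reflexive (*-assoc 16 r a))
                                      (≤-trans (*-monoʳ-≤ 16 ra≤2b) (≤-reflexive (sym (*-assoc 16 2 b))))) ⟩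
      2 ^ (32 * b)                ≡⟨ *-identityˡ _ ⟨
      1 * 2 ^ (32 * b)            ≡⟨ cong (_* 2 ^ (32 * b)) (^-zeroˡ (1 * a)) ⟨
      1 ^ (1 * a) * 2 ^ (32 * b)  ∎
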